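{- Let $q$ be a prime power and let $\Psi \in Aut(\overrightarrow{\Gamma_{l-i}}(M_2(F_q)))$. Then there exists a permutation $\rho$ of $M_2(F_q)$ that maps $R_i$ onto $R_i$ for each $i = 0,1,2$, such that $\rho = \Psi$ (that is, every automorphism $\Psi$ is a permutation of $M_2(F_q)$ that permutes the elements of each $R_i$ among themselves).
   Context: $F_q$ is the finite field with $q$ elements and $M_2(F_q)$ is the ring of all $2\times 2$ matrices over $F_q$. For $i=0,1,2$, $R_i = \{X \in M_2(F_q) : rank(X) = i\}$. For $X \in M_2(F_q)$, $[X] = \{AX : A \in M_2(F_q)\}$ is the left ideal generated by $X$. The left-ideal relation graph $\overrightarrow{\Gamma_{l-i}}(M_2(F_q))$ is the directed graph with vertex set $M_2(F_q)$ and a directed edge $X \rightarrow Y$ if and only if $[X]$ is properly contained in $[Y]$. An automorphism of a directed graph is a permutation $f$ of its vertex set such that $f(u) \rightarrow f(v)$ if and only if $u \rightarrow v$; $Aut$ denotes the group of automorphisms. -}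

module Defs where

open import Level using (Level; _⊔_; suc)
open import Algebra.Apartness.Bundles using (HeytingCommutativeRing; HeytingField)
open import Algebra.Bundles using (CommutativeRing)
import Algebra.Properties.Semiring.Sum as SemiringSum
open import Data.Fin.Base using (Fin)
open import Data.Nat.Base as ℕ using (ℕ; _^_)
open import Data.Nat.Primality using (Prime)
open import Data.Product.Base using (∃; ∃₂; _×_)
open import Data.Vec.Functional using (Vector)
import Data.Vec.Functional.Relation.Binary.Equality.Setoid as VecEq
open import Function.Bundles using (Inverse; _⇔_)
open import Relation.Binary.Bundles using (Setoid)
open import Relation.Binary.Core using (Rel)
open import Relation.Binary.PropositionalEquality using (_≡_)
import Relation.Binary.PropositionalEquality.Properties as ≡
open import Relation.Unary using (Pred; _∈_; _⊂_; _≐_)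

private
  variable
    a c ℓ ℓ₁ ℓ₂ : Level

IsPrimePower : ℕ → Set
IsPrimePower q = ∃₂ λ p k → Prime p × 1 ℕ.≤ k × q ≡ p ^ k

HasCardinality : Setoid a ℓ → ℕ → Set (a ⊔ ℓ)
HasCardinality S q = Inverse (≡.setoid (Fin q)) S

Permutation : Setoid a ℓ → Set (a ⊔ ℓ)
Permutation S = Inverse S S

-- The image of P under f, read up to the equality of S, equals P.

MapsOnto : (S : Setoid a ℓ) → Permutation S → Pred (Setoid.Carrier S) ℓ₁ →
           Set (a ⊔ ℓ ⊔ ℓ₁)
MapsOnto S f P = (λ y → ∃ λ x → x ∈ P × to x ≈ y) ≐ P
  where
  open Setoid S using (_≈_)
  open Inverse f using (to)

record Digraph a ℓ ℓ₁ : Set (suc (a ⊔ ℓ ⊔ ℓ₁)) where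
  infix 4 _⟶_
  field
    vertices : Setoid a ℓ
    _⟶_      : Rel (Setoid.Carrier vertices) ℓ₁

record Automorphism (G : Digraph a ℓ ℓ₁) : Set (a ⊔ ℓ ⊔ ℓ₁) where
  open Digraph G
  field
    permutation : Permutation vertices
  open Inverse permutation public using (to)
  field
    edges : ∀ u v → (to u ⟶ to v) ⇔ (u ⟶ v)

-- For a field with finitely many elements equality is decidable, so that
-- apartness is just inequality and a Heyting field is a field in the
-- usual sense; 0# and 1# are distinct in any Heyting field.

module LinearAlgebra (F : HeytingField c ℓ₁ ℓ₂) where

  open HeytingField F using (heytingCommutativeRing)
  open HeytingCommutativeRing heytingCommutativeRing using (commutativeRing)
  open CommutativeRing commutativeRing public
    using (Carrier; _≈_; _*_; 0#; semiring; setoid)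
  open SemiringSum semiring using (sum-syntax)
  open VecEq setoid public using (_≋_; ≋-setoid)

  Matrix : ℕ → ℕ → Set c
  Matrix m n = Vector (Vector Carrier n) m

  matrixSetoid : ℕ → ℕ → Setoid c ℓ₁
  matrixSetoid m n = VecEq.≋-setoid (≋-setoid n) m

  infix 4 _≈ᴹ_
  _≈ᴹ_ : ∀ {m n} → Rel (Matrix m n) ℓ₁
  _≈ᴹ_ {m} {n} = Setoid._≈_ (matrixSetoid m n)

  infixl 7 _*ᴹ_
  _*ᴹ_ : ∀ {l m n} → Matrix l m → Matrix m n → Matrix l n
  _*ᴹ_ {m = m} A B i j = ∑[ k < m ] (A i k * B k j)

  linearCombination : ∀ {m n} → Vector Carrier m → Vector (Vector Carrier n) m →
                      Vector Carrier n
  linearCombination {m} a v j = ∑[ i < m ] (a i * v i j)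

  Span : ∀ {m n} → Vector (Vector Carrier n) m → Pred (Vector Carrier n) (c ⊔ ℓ₁)
  Span v w = ∃ λ a → w ≋ linearCombination a v

  LinearlyIndependent : ∀ {m n} → Vector (Vector Carrier n) m → Set (c ⊔ ℓ₁)
  LinearlyIndependent v =
    ∀ a → linearCombination a v ≋ (λ _ → 0#) → ∀ i → a i ≈ 0#

  IsBasisOf : ∀ {r n} → Vector (Vector Carrier n) r →
              Pred (Vector Carrier n) (c ⊔ ℓ₁) → Set (c ⊔ ℓ₁)
  IsBasisOf b V = LinearlyIndependent b × Span b ≐ V

  -- A matrix is the vector of its rows, so this is its row space.

  RowSpace : ∀ {m n} → Matrix m n → Pred (Vector Carrier n) (c ⊔ ℓ₁)
  RowSpace X = Span X

  -- Rank as a relation rather than a function: the row space of X has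
  -- dimension r.

  HasRank : ∀ {m n} → Matrix m n → ℕ → Set (c ⊔ ℓ₁)
  HasRank X r = ∃ λ b → IsBasisOf {r} b (RowSpace X)

  RankClass : ∀ n → ℕ → Pred (Matrix n n) (c ⊔ ℓ₁)
  RankClass n r X = HasRank X r

  LeftIdeal : ∀ {n} → Matrix n n → Pred (Matrix n n) (c ⊔ ℓ₁)
  LeftIdeal {n} X Z = ∃ λ (A : Matrix n n) → Z ≈ᴹ A *ᴹ X

  leftIdealRelationGraph : ℕ → Digraph c ℓ₁ (c ⊔ ℓ₁)
  leftIdealRelationGraph n = record
    { vertices = matrixSetoid n n
    ; _⟶_      = λ X Y → LeftIdeal X ⊂ LeftIdeal Y
    }

{-# OPTIONS --safe #-}

-- An automorphism preserves the sources and the sinks of the graph. Since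
-- [X] ⊆ [Y] means that the row space of X is contained in that of Y, the
-- sources are the matrices of rank 0 and the sinks those of full rank; for
-- 2 × 2 matrices rank 1 is what remains. The dimension theory needed comes
-- from counting: m independent vectors in Fⁿ embed Fᵐ into Fⁿ, so that
-- q ^ m ≤ q ^ n.

module Submission where

open import Defs
open import Algebra.Apartness.Bundles using (HeytingCommutativeRing; HeytingField)
import Algebra.Apartness.Properties.HeytingCommutativeRing as HeytingProperties
open import Algebra.Bundles using (CommutativeRing)
import Algebra.Properties.Group as GroupProperties
import Algebra.Properties.Ring as RingProperties
import Algebra.Properties.Semiring.Sum as SemiringSum
open import Data.Fin.Base using (Fin; zero; suc; toℕ; combine; finToFun; funToFin)
open import Data.Fin.Properties as Fin
  using (any?; injective⇒≤; ¬∀⟶∃¬; funToFin-finToFin; finToFun-funToFin)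
open import Data.Nat.Base using (ℕ; zero; suc; _≤_; _<_; z≤n; s≤s; _^_)
open import Data.Nat.Properties using (^-monoʳ-<; ≮⇒≥; <⇒≱; n≮0; ≤-antisym)
open import Data.Product.Base using (∃; _×_; _,_; proj₁; proj₂)
open import Data.Vec.Functional using (Vector; _∷_; tail)
import Data.Vec.Functional.Relation.Binary.Pointwise.Properties as Pointwise
open import Function.Base using (_∘_; id)
open import Function.Bundles using (Inverse; Equivalence; mk⇔)
import Function.Construct.Symmetry as Symmetry
open import Level using (Level)
open import Relation.Binary.Bundles using (Setoid)
open import Relation.Binary.Definitions using (Decidable)
open import Relation.Binary.PropositionalEquality as ≡ using (_≡_; _≢_; _≗_)
import Relation.Binary.Reasoning.Setoid as SetoidReasoning
open import Relation.Nullary.Decidable using (Dec; yes; no; map′)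
open import Relation.Nullary.Negation using (¬_; contradiction)
open import Relation.Unary using (_∈_; _∉_; _⊆_; _⊂_)

private
  variable
    a c ℓ ℓ₁ ℓ₂ : Level

-- Sources and sinks of a digraph under its automorphisms.

module DigraphProperties (G : Digraph a ℓ ℓ₁) where

  open Digraph G
  open Setoid vertices

  Source Sink : Carrier → Set _
  Source x = ∀ y → ¬ y ⟶ x
  Sink x   = ∀ y → ¬ x ⟶ y

  -- A `Digraph` does not by itself make its edges respect `≈`, and a permutation cancels against
  -- its inverse only up to `≈`, so this compatibility is assumed here.
  module _ (⟶-resp : ∀ {u u′ v v′} → u ≈ u′ → v ≈ v′ → u ⟶ v → u′ ⟶ v′) where

    inverse : Automorphism G → Automorphism G
    inverse Ψ = record
      { permutation = Symmetry.inverse permutation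
      ; edges       = λ u v → mk⇔
          (λ e → ⟶-resp (strictlyInverseˡ u) (strictlyInverseˡ v)
                   (Equivalence.from (edges _ _) e))
          (λ e → Equivalence.to (edges _ _)
                   (⟶-resp (sym (strictlyInverseˡ u)) (sym (strictlyInverseˡ v)) e))
      }
      where
      open Automorphism Ψ using (permutation; edges)
      open Inverse permutation using (strictlyInverseˡ)

    module _ (Ψ : Automorphism G) where
      open Automorphism Ψ
      open Inverse permutation using (from; strictlyInverseˡ)

      -- An edge into `to x` pulls back along `from` to an edge into `x`, once its other end `y` is
      -- rewritten as `to (from y)`.
      source-preserved : ∀ {x} → Source x → Source (to x)
      source-preserved s y e = s (from y)
        (Equivalence.to (edges _ _) (⟶-resp (sym (strictlyInverseˡ y)) refl e))

      sink-preserved : ∀ {x} → Sink x → Sink (to x)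
      sink-preserved s y e = s (from y)
        (Equivalence.to (edges _ _) (⟶-resp refl (sym (strictlyInverseˡ y)) e))

-- Linear combinations, spans and independence.

module LinearAlgebraProperties (F : HeytingField c ℓ₁ ℓ₂) where

  open LinearAlgebra F
  open HeytingField F using (heytingCommutativeRing; _#_; tight; #⇒invertible)
  open HeytingProperties heytingCommutativeRing using (x-0≈x; 1#0)
  open HeytingCommutativeRing heytingCommutativeRing using (commutativeRing)
  open CommutativeRing commutativeRing
    hiding (Carrier; _≈_; _*_; 0#; semiring; setoid; zero)
  open GroupProperties +-group using (identityˡ-unique; inverseˡ-unique; x∙y⁻¹≈ε⇒x≈y)
  open RingProperties ring using (-‿distribˡ-*; -‿distribʳ-*)
  open SemiringSum semiring
  open SetoidReasoning setoid

  linearCombination-cong : ∀ {m n} {a b : Vector Carrier m} {v w : Matrix m n} →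
    a ≋ b → v ≈ᴹ w → linearCombination a v ≋ linearCombination b w
  linearCombination-cong a≋b v≈w j = sum-cong-≋ (λ i → *-cong (a≋b i) (v≈w i j))

  linearCombination-0 : ∀ {m n} (v : Matrix m n) →
    linearCombination (λ _ → 0#) v ≋ (λ _ → 0#)
  linearCombination-0 {m} v j =
    trans (sum-cong-≋ (λ i → zeroˡ (v i j))) (sum-replicate-zero m)

  linearCombination-+ : ∀ {m n} (a b : Vector Carrier m) (v : Matrix m n) →
    linearCombination (λ i → a i + b i) v ≋
    (λ j → linearCombination a v j + linearCombination b v j)
  linearCombination-+ a b v j = trans
    (sum-cong-≋ (λ i → distribʳ (v i j) (a i) (b i)))
    (∑-distrib-+ (λ i → a i * v i j) (λ i → b i * v i j))

  linearCombination-* : ∀ {m n} s (a : Vector Carrier m) (v : Matrix m n) →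
    linearCombination (λ i → s * a i) v ≋ (λ j → s * linearCombination a v j)
  linearCombination-* s a v j = trans
    (sum-cong-≋ (λ i → *-assoc s (a i) (v i j)))
    (sym (*-distribˡ-sum s (λ i → a i * v i j)))

  -- Associativity of the product row times matrix times matrix: distribute, exchange the two finite
  -- sums, and factor out again.
  linearCombination-assoc : ∀ {k m n}
    (a : Vector Carrier k) (B : Matrix k m) (v : Matrix m n) →
    linearCombination (linearCombination a B) v ≋
    linearCombination a (λ i → linearCombination (B i) v)
  linearCombination-assoc {k} {m} a B v j = begin
    ∑[ l < m ] (∑[ i < k ] (a i * B i l) * v l j)
      ≈⟨ sum-cong-≋ (λ l → *-distribʳ-sum (v l j) (λ i → a i * B i l)) ⟩
    ∑[ l < m ] ∑[ i < k ] (a i * B i l * v l j)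
      ≈⟨ ∑-comm (λ l i → a i * B i l * v l j) ⟩
    ∑[ i < k ] ∑[ l < m ] (a i * B i l * v l j)
      ≈⟨ sum-cong-≋ (λ i → sum-cong-≋ (λ l → *-assoc (a i) (B i l) (v l j))) ⟩
    ∑[ i < k ] ∑[ l < m ] (a i * (B i l * v l j))
      ≈⟨ sum-cong-≋ (λ i → *-distribˡ-sum (a i) (λ l → B i l * v l j)) ⟨
    ∑[ i < k ] (a i * ∑[ l < m ] (B i l * v l j))
      ∎

  -- Recursion on the row index lets sums against this matrix be evaluated by splitting off their
  -- first term.
  identityMatrix : ∀ {n} → Matrix n n
  identityMatrix zero    = 1# ∷ λ _ → 0#
  identityMatrix (suc i) = 0# ∷ identityMatrix i

  linearCombination-identityˡ : ∀ {m n} i (v : Matrix m n) →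
    linearCombination (identityMatrix i) v ≋ v i
  linearCombination-identityˡ zero v j = trans
    (+-cong (*-identityˡ (v zero j)) (linearCombination-0 (tail v) j))
    (+-identityʳ (v zero j))
  linearCombination-identityˡ (suc i) v j = trans
    (+-cong (zeroˡ (v zero j)) (linearCombination-identityˡ i (tail v) j))
    (+-identityˡ (v (suc i) j))

  linearCombination-identityʳ : ∀ {n} (a : Vector Carrier n) →
    linearCombination a identityMatrix ≋ a
  linearCombination-identityʳ {suc n} a zero = trans
    (+-cong (*-identityʳ (a zero))
      (trans (sum-cong-≋ (λ i → zeroʳ (a (suc i)))) (sum-replicate-zero n)))
    (+-identityʳ (a zero))
  linearCombination-identityʳ {suc n} a (suc j) = trans
    (+-cong (zeroʳ (a zero)) (linearCombination-identityʳ (tail a) j))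
    (+-identityˡ (a (suc j)))

  Span-cong : ∀ {m n} {v w : Matrix m n} → v ≈ᴹ w → Span v ⊆ Span w
  Span-cong v≈w (a , x≋av) =
    a , λ j → trans (x≋av j) (linearCombination-cong (λ _ → refl) v≈w j)

  row∈Span : ∀ {m n} (v : Matrix m n) i → v i ∈ Span v
  row∈Span v i = identityMatrix i , λ j → sym (linearCombination-identityˡ i v j)

  -- Substituting combinations of `w` for the vectors of `v` multiplies the coefficients `a` by the
  -- matrix `B`. Inclusions of spans are thereby checked on generators.
  Span-least : ∀ {k m n} (v : Matrix k n) (w : Matrix m n) →
    (∀ i → v i ∈ Span w) → Span v ⊆ Span w
  Span-least v w v∈w {x} (a , x≋av) =
    linearCombination a B , λ j → begin
      x j                                             ≈⟨ x≋av j ⟩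
      linearCombination a v j
        ≈⟨ linearCombination-cong (λ _ → refl) (proj₂ ∘ v∈w) j ⟩
      linearCombination a (λ i → linearCombination (B i) w) j
        ≈⟨ linearCombination-assoc a B w j ⟨
      linearCombination (linearCombination a B) w j   ∎
    where B = proj₁ ∘ v∈w

  Span-tail : ∀ {m n} (v : Matrix (suc m) n) → Span (tail v) ⊆ Span v
  Span-tail v = Span-least (tail v) v (row∈Span v ∘ suc)

  -- Tightness makes it enough to refute a zero # 0#, so that no inverse of a
  -- merely nonzero element has to be found.

  ∷-independent : ∀ {m n} {w} {v : Matrix m n} →
    LinearlyIndependent v → w ∉ Span v → LinearlyIndependent (w ∷ v)
  ∷-independent {w = w} {v} v-indep w∉v a aw≋0 = λ where
      zero    → a₀≈0
      (suc i) → v-indep (tail a) tail≋0 i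
    where
    b : Vector Carrier _
    b = linearCombination (tail a) v

    a₀≈0 : a zero ≈ 0#
    a₀≈0 = proj₁ (tight (a zero) 0#) λ a₀#0 →
      let e , ea₀≈1 , _ = #⇒invertible a₀#0 in
      w∉v ((λ i → - e * tail a i) , λ j → begin
        w j                                           ≈⟨ *-identityˡ (w j) ⟨
        1# * w j                                      ≈⟨ *-congʳ ea₀≈1 ⟨
        e * (a zero - 0#) * w j                       ≈⟨ *-assoc e _ (w j) ⟩
        e * ((a zero - 0#) * w j)                     ≈⟨ *-congˡ (*-congʳ (x-0≈x (a zero))) ⟩
        e * (a zero * w j)                            ≈⟨ *-congˡ (inverseˡ-unique _ _ (aw≋0 j)) ⟩
        e * - b j                                     ≈⟨ -‿distribʳ-* e (b j) ⟨
        - (e * b j)                                   ≈⟨ -‿distribˡ-* e (b j) ⟩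
        - e * b j                                     ≈⟨ linearCombination-* (- e) (tail a) v j ⟨
        linearCombination (λ i → - e * tail a i) v j  ∎)

    tail≋0 : b ≋ (λ _ → 0#)
    tail≋0 j = begin
      b j                 ≈⟨ +-identityˡ (b j) ⟨
      0# + b j            ≈⟨ +-congʳ (zeroˡ (w j)) ⟨
      0# * w j + b j      ≈⟨ +-congʳ (*-congʳ a₀≈0) ⟨
      a zero * w j + b j  ≈⟨ aw≋0 j ⟩
      0#                  ∎

  -- A linear map with trivial kernel is injective: independence is applied to `a - b`.
  independent⇒injective : ∀ {m n} {v : Matrix m n} → LinearlyIndependent v →
    ∀ a b → linearCombination a v ≋ linearCombination b v → a ≋ b
  independent⇒injective {v = v} v-indep a b av≋bv i =
    x∙y⁻¹≈ε⇒x≈y (a i) (b i) (v-indep (λ i → a i - b i) difference≋0 i)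
    where
    a-b+b≈a : ∀ i → a i - b i + b i ≈ a i
    a-b+b≈a i = begin
      a i - b i + b i      ≈⟨ +-assoc (a i) (- b i) (b i) ⟩
      a i + (- b i + b i)  ≈⟨ +-congˡ (-‿inverseˡ (b i)) ⟩
      a i + 0#             ≈⟨ +-identityʳ (a i) ⟩
      a i                  ∎

    difference≋0 : linearCombination (λ i → a i - b i) v ≋ (λ _ → 0#)
    -- Adding the combination with coefficients `b` gives the one with coefficients `a`, which
    -- equals that of `b`; hence the summand added to it is neutral.
    difference≋0 j = identityˡ-unique _ (linearCombination b v j) (begin
      linearCombination (λ i → a i - b i) v j + linearCombination b v j
        ≈⟨ linearCombination-+ (λ i → a i - b i) b v j ⟨
      linearCombination (λ i → a i - b i + b i) v j
        ≈⟨ linearCombination-cong {v = v} a-b+b≈a (λ _ _ → refl) j ⟩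
      linearCombination a v j
        ≈⟨ av≋bv j ⟩
      linearCombination b v j
        ∎)

  -- A relation among the coordinate rows `B` gives the same relation among the vectors `v`, since
  -- `v` is `B` applied to `w`. This moves independent vectors from a span of `m` vectors into the
  -- coordinate space of dimension `m`.
  coordinates-independent : ∀ {k m n} {v : Matrix k n} {w : Matrix m n} →
    LinearlyIndependent v → (v∈w : ∀ i → v i ∈ Span w) →
    LinearlyIndependent (proj₁ ∘ v∈w)
  coordinates-independent {v = v} {w} v-indep v∈w a aB≋0 = v-indep a λ j → begin
    linearCombination a v j
      ≈⟨ linearCombination-cong (λ _ → refl) (proj₂ ∘ v∈w) j ⟩
    linearCombination a (λ i → linearCombination (B i) w) j
      ≈⟨ linearCombination-assoc a B w j ⟨
    linearCombination (linearCombination a B) w j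
      ≈⟨ linearCombination-cong {v = w} aB≋0 (λ _ _ → refl) j ⟩
    linearCombination (λ _ → 0#) w j
      ≈⟨ linearCombination-0 w j ⟩
    0#
      ∎
    where B = proj₁ ∘ v∈w

  identity-independent : ∀ {n} → LinearlyIndependent (identityMatrix {n})
  identity-independent a a≋0 i =
    trans (sym (linearCombination-identityʳ a i)) (a≋0 i)

  Span-identity : ∀ {n} (w : Vector Carrier n) → w ∈ Span identityMatrix
  Span-identity w = w , λ j → sym (linearCombination-identityʳ w j)

  1≉0 : ¬ 1# ≈ 0#
  1≉0 1≈0 = proj₂ (tight 1# 0#) 1≈0 1#0

  HasRank-resp : ∀ {m n r} {X Y : Matrix m n} → X ≈ᴹ Y → HasRank X r → HasRank Y r
  HasRank-resp X≈Y (b , b-indep , b⊆X , X⊆b) =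
    b , b-indep , Span-cong X≈Y ∘ b⊆X , X⊆b ∘ Span-cong (λ i j → sym (X≈Y i j))

  -- Left ideals and row spaces.

  module _ {n : ℕ} where

    open Digraph (leftIdealRelationGraph n) using (_⟶_)

    -- Row `i` of `A *ᴹ X` is by definition the combination of the rows of `X` with coefficients
    -- `A i`, so membership in a left ideal is membership of every row in the row space.
    LeftIdeal⁺ : ∀ {X Y : Matrix n n} → Span X ⊆ Span Y → LeftIdeal X ⊆ LeftIdeal Y
    LeftIdeal⁺ X⊆Y (A , Z≈AX) = proj₁ ∘ rows , proj₂ ∘ rows
      where rows = λ i → X⊆Y (A i , Z≈AX i)

    -- `X` lies in its own left ideal, with the identity matrix as multiplier; hence `X` is `A *ᴹ Y`
    -- for some `A`, which places each row of `X` in the row space of `Y`.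
    LeftIdeal⁻ : ∀ {X Y : Matrix n n} → LeftIdeal X ⊆ LeftIdeal Y → Span X ⊆ Span Y
    LeftIdeal⁻ {X} {Y} X⊆Y =
      let A , X≈AY = X⊆Y (proj₁ ∘ row∈Span X , proj₂ ∘ row∈Span X) in
      Span-least X Y (λ i → A i , X≈AY i)

    edge⁺ : ∀ {X Y} → Span X ⊂ Span Y → X ⟶ Y
    edge⁺ (X⊆Y , Y⊈X) = LeftIdeal⁺ X⊆Y , λ Y⊆X → Y⊈X (LeftIdeal⁻ Y⊆X)

    edge⁻ : ∀ {X Y} → X ⟶ Y → Span X ⊂ Span Y
    edge⁻ (X⊆Y , Y⊈X) = LeftIdeal⁻ X⊆Y , λ Y⊆X → Y⊈X (LeftIdeal⁺ Y⊆X)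

    edge-resp : ∀ {X X′ Y Y′} → X ≈ᴹ X′ → Y ≈ᴹ Y′ → X ⟶ Y → X′ ⟶ Y′
    edge-resp X≈X′ Y≈Y′ e =
      let X⊆Y , Y⊈X = edge⁻ e in
      edge⁺ ( Span-cong Y≈Y′ ∘ X⊆Y ∘ Span-cong (λ i j → sym (X≈X′ i j))
            , λ Y′⊆X′ → Y⊈X (Span-cong (λ i j → sym (X≈X′ i j)) ∘ Y′⊆X′ ∘ Span-cong Y≈Y′))

-- Counting and rank over a finite field.

funToFin-cong : ∀ {m n} {f g : Fin m → Fin n} → f ≗ g → funToFin f ≡ funToFin g
funToFin-cong {zero}  f≗g = ≡.refl
funToFin-cong {suc m} f≗g = ≡.cong₂ combine (f≗g zero) (funToFin-cong (f≗g ∘ suc))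

distinct⇒1< : ∀ {n} (i j : Fin n) → i ≢ j → 1 < n
distinct⇒1< {suc zero}    zero zero i≢j = contradiction ≡.refl i≢j
distinct⇒1< {suc (suc n)} i    j    i≢j = s≤s (s≤s z≤n)

module FiniteField (F : HeytingField c ℓ₁ ℓ₂) {q : ℕ}
  (finite : HasCardinality (LinearAlgebra.setoid F) q) where

  open LinearAlgebra F
  open LinearAlgebraProperties F
  open HeytingField F using (1#; refl; sym; trans)
  open Inverse finite using (to; from; from-cong; strictlyInverseˡ; strictlyInverseʳ)

  from-injective : ∀ {x y} → from x ≡ from y → x ≈ y
  from-injective {x} {y} eq = trans (sym (strictlyInverseˡ x))
    (trans (Inverse.to-cong finite eq) (strictlyInverseˡ y))

  1<q : 1 < q
  1<q = distinct⇒1< (from 1#) (from 0#) (1≉0 ∘ from-injective)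

  infix 4 _≟_ _∈Span?_

  _≟_ : Decidable _≈_
  x ≟ y = map′ from-injective from-cong (from x Fin.≟ from y)

  -- Up to the enumeration of the field, the coordinates of a vector are the base `q` digits of its
  -- code.
  decode : ∀ {n} → Fin (q ^ n) → Vector Carrier n
  decode k i = to (finToFun k i)

  encode : ∀ {n} → Vector Carrier n → Fin (q ^ n)
  encode a = funToFin (from ∘ a)

  decode-encode : ∀ {n} (a : Vector Carrier n) → decode (encode a) ≋ a
  decode-encode a i = trans
    (Inverse.to-cong finite (finToFun-funToFin (from ∘ a) i)) (strictlyInverseˡ (a i))

  encode-injective : ∀ {n} {a b : Vector Carrier n} → encode a ≡ encode b → a ≋ b
  encode-injective {a = a} {b} eq i = trans (sym (decode-encode a i))
    (trans (Inverse.to-cong finite (≡.cong (λ k → finToFun k i) eq)) (decode-encode b i))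

  decode-injective : ∀ {n} {k l : Fin (q ^ n)} → decode {n} k ≋ decode l → k ≡ l
  decode-injective {n} {k} {l} eq = begin
    k                                  ≡⟨ encode-decode k ⟨
    encode {n} (decode k)              ≡⟨ funToFin-cong {n} (λ i → from-cong (eq i)) ⟩
    encode {n} (decode l)              ≡⟨ encode-decode l ⟩
    l                                  ∎
    where
    open ≡.≡-Reasoning
    encode-decode : ∀ k → encode {n} (decode k) ≡ k
    encode-decode k = ≡.trans
      (funToFin-cong {n} (λ i → strictlyInverseʳ (finToFun {q} {n} k i)))
      (funToFin-finToFin {n} {q} k)

  -- Exhaustive search through the `q ^ m` coefficient vectors.
  _∈Span?_ : ∀ {m n} w (v : Matrix m n) → Dec (w ∈ Span v)
  w ∈Span? v = map′
    (λ (k , eq) → decode k , eq)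
    (λ (a , eq) → encode a , λ j → trans (eq j)
      (linearCombination-cong {v = v} (λ i → sym (decode-encode a i)) (λ _ _ → refl) j))
    (any? (λ k → Pointwise.decidable _≟_ w (linearCombination (decode k) v)))

  independent⇒≤ : ∀ {m n} {v : Matrix m n} → LinearlyIndependent v → m ≤ n
  independent⇒≤ {m} {n} {v} v-indep = ≮⇒≥ λ n<m →
    -- Powers of `q` increase strictly because `1 < q`, so `n < m` contradicts the injection `f`.
    <⇒≱ (^-monoʳ-< q 1<q n<m) (injective⇒≤ {f = f} f-injective)
    where
    f : Fin (q ^ m) → Fin (q ^ n)
    f k = encode (linearCombination (decode k) v)

    f-injective : ∀ {k l} → f k ≡ f l → k ≡ l
    f-injective eq =
      decode-injective {m} (independent⇒injective v-indep _ _ (encode-injective {n} eq))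

  -- The Steinitz bound, reduced to the coordinate space by replacing `v` with its coordinate rows.
  independent-in-Span⇒≤ : ∀ {k m n} {v : Matrix k n} {w : Matrix m n} →
    LinearlyIndependent v → (∀ i → v i ∈ Span w) → k ≤ m
  independent-in-Span⇒≤ {w = w} v-indep v∈w =
    independent⇒≤ (coordinates-independent {w = w} v-indep v∈w)

  -- A basis is selected greedily from the last row upwards: a row is kept exactly when it lies
  -- outside the span of the rows already kept.
  rank-exists : ∀ {m n} (X : Matrix m n) → ∃ (HasRank X)
  rank-exists {zero}  X = 0 , X , (λ a _ ()) , id , id
  rank-exists {suc m} X with rank-exists (tail X)
  ... | r , b , b-indep , b⊆X , X⊆b with X zero ∈Span? b
  ... | yes X₀∈b = r , b , b-indep , Span-tail X ∘ b⊆X , Span-least X b λ where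
        zero    → X₀∈b
        (suc i) → X⊆b (row∈Span (tail X) i)
  ... | no  X₀∉b = suc r , X₀∷b , ∷-independent b-indep X₀∉b ,
        Span-least X₀∷b X (λ where
          zero    → row∈Span X zero
          (suc i) → Span-tail X (b⊆X (row∈Span b i))) ,
        Span-least X X₀∷b (λ where
          zero    → row∈Span X₀∷b zero
          (suc i) → Span-tail X₀∷b (X⊆b (row∈Span (tail X) i)))
    where X₀∷b = X zero ∷ b

  rank-mono : ∀ {k m n r s} {X : Matrix k n} {Y : Matrix m n} →
    HasRank X r → HasRank Y s → Span X ⊆ Span Y → r ≤ s
  rank-mono (b , b-indep , b⊆X , _) (c , _ , _ , Y⊆c) X⊆Y =
    independent-in-Span⇒≤ {w = c} b-indep (λ i → Y⊆c (X⊆Y (b⊆X (row∈Span b i))))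

  rank-≤ : ∀ {m n r} {X : Matrix m n} → HasRank X r → r ≤ n
  rank-≤ (_ , b-indep , _) = independent⇒≤ b-indep

  -- Some basis vector of the larger space lies outside the smaller one; prepending it to `b` yields
  -- `suc r` independent vectors in `Span Y`.
  rank-strict : ∀ {k m n r s} {X : Matrix k n} {Y : Matrix m n} →
    HasRank X r → HasRank Y s → Span X ⊂ Span Y → r < s
  rank-strict {s = s} (b , b-indep , b⊆X , X⊆b) (c , _ , c⊆Y , Y⊆c) (X⊆Y , Y⊈X) =
    -- Were every `c j` in `Span b`, the reverse inclusion would follow; decidable membership turns
    -- this refutation into an actual index `j`.
    let j , cⱼ∉b = ¬∀⟶∃¬ s _ (λ j → c j ∈Span? b)
                     (λ c∈b → Y⊈X (b⊆X ∘ Span-least c b c∈b ∘ Y⊆c))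
    in independent-in-Span⇒≤ {v = c j ∷ b} {c} (∷-independent b-indep cⱼ∉b) λ where
      zero    → row∈Span c j
      (suc i) → Y⊆c (X⊆Y (b⊆X (row∈Span b i)))

  -- Sources as rank 0, sinks as full rank.

  module _ {n : ℕ} where

    open DigraphProperties (leftIdealRelationGraph n)

    rank-0⇒source : ∀ {X} → HasRank X 0 → Source X
    rank-0⇒source p Y Y⟶X = n≮0 (rank-strict (proj₂ (rank-exists Y)) p (edge⁻ Y⟶X))

    full-rank⇒sink : ∀ {X} → HasRank X n → Sink X
    full-rank⇒sink p Y X⟶Y =
      let _ , p′ = rank-exists Y in
      <⇒≱ (rank-strict p p′ (edge⁻ X⟶Y)) (rank-≤ p′)

    source⇒rank-0 : ∀ {X r} → Source X → HasRank X r → r ≡ 0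
    source⇒rank-0 {r = zero}  s p = ≡.refl
    -- A matrix of positive rank receives an edge from the zero matrix.
    source⇒rank-0 {X} {suc r} s p = contradiction (edge⁺ (0⊆X , X⊈0)) (s zeroMatrix)
      where
      zeroMatrix : Matrix n n
      zeroMatrix _ _ = 0#

      0⊆X : Span zeroMatrix ⊆ Span X
      0⊆X = Span-least zeroMatrix X (λ _ → (λ _ → 0#) , λ j → sym (linearCombination-0 X j))

      zeroMatrix-rank : HasRank zeroMatrix 0
      zeroMatrix-rank =
        (λ ()) , (λ a _ ()) ,
        Span-least (λ ()) zeroMatrix (λ ()) ,
        Span-least zeroMatrix (λ ()) (λ _ → (λ ()) , λ _ → refl)

      X⊈0 : ¬ Span X ⊆ Span zeroMatrix
      X⊈0 X⊆0 = n≮0 (rank-mono p zeroMatrix-rank X⊆0)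

    sink⇒full-rank : ∀ {X r} → Sink X → HasRank X r → r ≡ n
    sink⇒full-rank {X} s p = ≤-antisym (rank-≤ p) (≮⇒≥ λ r<n →
      -- The rows of the identity matrix span the whole space, so any `X` of rank below `n` has an
      -- edge to it.
      s identityMatrix (edge⁺
        ( (λ _ → Span-identity _)
        , λ I⊆X → <⇒≱ r<n (rank-mono identity-rank p I⊆X))))
      where
      identity-rank : HasRank (identityMatrix {n}) n
      identity-rank = identityMatrix , identity-independent , id , id

    module _ (Ψ : Automorphism (leftIdealRelationGraph n)) where

      open Automorphism Ψ using () renaming (to to ψ)

      rank-0-preserved : ∀ {X r} → HasRank X 0 → HasRank (ψ X) r → r ≡ 0
      rank-0-preserved p =
        source⇒rank-0 (source-preserved edge-resp Ψ (rank-0⇒source p))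

      full-rank-preserved : ∀ {X r} → HasRank X n → HasRank (ψ X) r → r ≡ n
      full-rank-preserved p =
        sink⇒full-rank (sink-preserved edge-resp Ψ (full-rank⇒sink p))

  -- Rank preservation for 2 × 2 matrices.

  module _ (Ψ : Automorphism (leftIdealRelationGraph 2)) where

    open Automorphism Ψ using (permutation) renaming (to to ψ)
    open Inverse permutation using ()
      renaming (from to ψ⁻¹; strictlyInverseˡ to ψψ⁻¹; strictlyInverseʳ to ψ⁻¹ψ)
    open DigraphProperties (leftIdealRelationGraph 2)
    open Setoid (matrixSetoid 2 2) using () renaming (sym to ≈ᴹ-sym)

    rank-≡ : ∀ {X} r s → HasRank X r → HasRank (ψ X) s → r ≡ s
    rank-≡ 0 s p p′ = ≡.sym (rank-0-preserved Ψ p p′)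
    -- The inverse automorphism sends `ψ X`, of rank 0, to a copy of `X`, of rank 1. Preservation of
    -- rank 0 then yields `1 ≡ 0`, which is the goal itself; the case of rank 2 below works
    -- likewise.
    rank-≡ 1 0 p p′ =
      rank-0-preserved (inverse edge-resp Ψ) p′ (HasRank-resp (≈ᴹ-sym (ψ⁻¹ψ _)) p)
    rank-≡ 1 1 p p′ = ≡.refl
    rank-≡ 1 2 p p′ =
      full-rank-preserved (inverse edge-resp Ψ) p′ (HasRank-resp (≈ᴹ-sym (ψ⁻¹ψ _)) p)
    -- Ranks above 2 exceed the number of columns.
    rank-≡ {X} 1 (suc (suc (suc _))) p p′ with s≤s (s≤s ()) ← rank-≤ {X = ψ X} p′
    rank-≡ 2 s p p′ = ≡.sym (full-rank-preserved Ψ p p′)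
    rank-≡ {X} (suc (suc (suc _))) s p p′ with s≤s (s≤s ()) ← rank-≤ {X = X} p

    rank-preserved : ∀ {X r} → HasRank X r → HasRank (ψ X) r
    rank-preserved {X} {r} p =
      let s , p′ = rank-exists (ψ X) in
      ≡.subst (HasRank (ψ X)) (≡.sym (rank-≡ r s p p′)) p′

    rank-reflected : ∀ {X r} → HasRank (ψ X) r → HasRank X r
    rank-reflected {X} {r} p′ =
      let s , p = rank-exists X in
      ≡.subst (HasRank X) (rank-≡ s r p p′) p

    -- Preservation puts the image inside the class; reflection, applied to `ψ⁻¹ Y`, shows that
    -- every `Y` in the class is attained.
    mapsOnto-rankClass : ∀ r → MapsOnto (matrixSetoid 2 2) permutation (RankClass 2 r)
    mapsOnto-rankClass r =
      (λ (X , p , ψX≈Y) → HasRank-resp ψX≈Y (rank-preserved p)) ,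
      (λ {Y} p → ψ⁻¹ Y , rank-reflected (HasRank-resp (≈ᴹ-sym (ψψ⁻¹ Y)) p) , ψψ⁻¹ Y)

theorem3p28 : ∀ {c ℓ₁ ℓ₂} (q : ℕ) → IsPrimePower q →
    (F : HeytingField c ℓ₁ ℓ₂) →
    let open LinearAlgebra F in
    HasCardinality setoid q →
    (Ψ : Automorphism (leftIdealRelationGraph 2)) →
    ∃ λ (ρ : Permutation (matrixSetoid 2 2)) →
    (∀ (i : Fin 3) → MapsOnto (matrixSetoid 2 2) ρ (RankClass 2 (toℕ i))) ×
    (∀ X → Inverse.to ρ X ≈ᴹ Automorphism.to Ψ X)
theorem3p28 q _ F finite Ψ =
  -- The permutation underlying `Ψ` serves as `ρ`, so their agreement is reflexivity.
  Automorphism.permutation Ψ ,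
  (λ i → FiniteField.mapsOnto-rankClass F finite Ψ (toℕ i)) ,
  (λ X i j → HeytingField.refl F)
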